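{- There is a universal constant $C$ such that the following holds. Let $f:\{0,1\}^n\to\{0,1\}$ be computed by a width-3, read-once, oblivious branching program of length $n$. Then for all $k\in[n]$, $$L^k(f):=\sum_{s\subseteq[n]:|s|=k}|\widehat f[s]|\le 8n^2\cdot\left(C\cdot\log_2(3n)\right)^k .$$
   Context: For $f:\{0,1\}^n\to\mathbb{R}$ and $s\subseteq[n]$, $\widehat f[s]=\mathbb{E}_U[f(U)(-1)^{\sum_{i\in s}U_i}]$ with $U$ uniform on $\{0,1\}^n$. A length-$n$, width-$w$ ordered branching program has layers of vertices $V_0,\dots,V_n$ with $|V_i|\le w$ and transition maps $T_i:V_{i-1}\times\{0,1\}\to V_i$; on input $x$ it starts at a fixed $u_0\in V_0$ and follows $T_i(\cdot,x_i)$ for $i=1,\dots,n$; it computes $f$ if for some $S\subseteq V_n$, $f(x)=1$ iff the final vertex lies in $S$. A read-once, oblivious branching program computes $x\mapsto f'(\pi(x))$ where $f'$ is computed by an ordered branching program and $\pi$ is a permutation of the coordinates. -}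

module Defs where

open import Data.Bool using (Bool; true; false; if_then_else_; _xor_; _∧_)
open import Data.Nat using (ℕ; zero; suc; _≤_) renaming (_+_ to _+ℕ_; _*_ to _*ℕ_; _^_ to _^ℕ_)
open import Data.Fin using (Fin; zero; suc)
open import Data.Fin.Subset using (Subset) renaming (∣_∣ to card)
open import Data.Fin.Permutation using (Permutation′; _⟨$⟩ʳ_)
open import Data.Vec using (Vec; []; _∷_; tabulate; lookup; zipWith; foldr)
open import Data.List using (List; map; _++_; filterᵇ) renaming ([] to []ᴸ; _∷_ to _∷ᴸ_)
open import Data.Rational using (ℚ; 0ℚ; 1ℚ; ½; -_; _+_; _*_; ∣_∣)
open import Data.Product using (Σ; ∃; _×_)
open import Relation.Binary.PropositionalEquality using (_≡_)
open import Data.Nat using (_≡ᵇ_)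

allBits : (n : ℕ) → List (Vec Bool n)
allBits zero = [] ∷ᴸ []ᴸ
allBits (suc n) = map (false ∷_) (allBits n) ++ map (true ∷_) (allBits n)

sumℚ : List ℚ → ℚ
sumℚ []ᴸ = 0ℚ
sumℚ (q ∷ᴸ qs) = q + sumℚ qs

half^ : ℕ → ℚ
half^ zero = 1ℚ
half^ (suc n) = ½ * half^ n

b2q : Bool → ℚ
b2q true = 1ℚ
b2q false = 0ℚ

parity : ∀ {n} → Subset n → Vec Bool n → Bool
parity s x = foldr _ _xor_ false (zipWith _∧_ s x)

chi : ∀ {n} → Subset n → Vec Bool n → ℚ
chi s x = if parity s x then - 1ℚ else 1ℚ

fourier : ∀ {n} → (Vec Bool n → Bool) → Subset n → ℚ
fourier {n} f s = half^ n * sumℚ (map (λ x → b2q (f x) * chi s x) (allBits n))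

Lk : ∀ {n} → ℕ → (Vec Bool n → Bool) → ℚ
Lk {n} k f = sumℚ (map (λ s → ∣ fourier f s ∣) (filterᵇ (λ s → card s ≡ᵇ k) (allBits n)))

-- Ordered branching program of length n and width w: every layer V_0..V_n
-- is (w.l.o.g., by padding) Fin w.
record OrderedBP (w n : ℕ) : Set where
  field
    start  : Fin w
    trans  : Fin n → Fin w → Bool → Fin w   -- trans i = T_{i+1}
    accept : Fin w → Bool

runFrom : ∀ {w n} → (Fin n → Fin w → Bool → Fin w) → Fin w → Vec Bool n → Fin w
runFrom T u [] = u
runFrom T u (b ∷ xs) = runFrom (λ i → T (suc i)) (T zero u b) xs

evalBP : ∀ {w n} → OrderedBP w n → Vec Bool n → Bool
evalBP P x = OrderedBP.accept P (runFrom (OrderedBP.trans P) (OrderedBP.start P) x)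

permuteBits : ∀ {n} → Permutation′ n → Vec Bool n → Vec Bool n
permuteBits π x = tabulate (λ i → lookup x (π ⟨$⟩ʳ i))

ROBP : (w n : ℕ) → (Vec Bool n → Bool) → Set
ROBP w n f = Σ (OrderedBP w n) λ P → Σ (Permutation′ n) λ π →
  ∀ x → f x ≡ evalBP P (permuteBits π x)

open import Data.Integer using (+_)
import Data.Rational as Q
natℚ : ℕ → ℚ
natℚ m = (+ m) Q./ 1

{-# OPTIONS --safe #-}
-- For p = 1/(24 ⌈log₂ 3n⌉) the weighted spectral norm ‖g‖ = Σ p^|s| |ĝ(s)| dominates p^k Lᵏ, and it
-- satisfies ‖g‖ = ‖even g‖ + p ‖odd g‖, where even and odd are the half sum and the half difference of
-- the two restrictions of the first bit. Write D(u,v) for the norm of the difference of the functions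
-- computed from states u and v of a layer. Passing to the previous layer, D(u,v) becomes at most
--     ½ min(D(u₀,v₀) + D(u₁,v₁), D(u₀,v₁) + D(u₁,v₀))
--       + ½ p min(D(u₀,v₀) + D(u₁,v₁), D(u₀,u₁) + D(v₀,v₁)).
-- The point is an invariant that keeps D bounded by 2 through all n layers: D fits into a triangle with
-- sides s, t, Λ in which s + σⱼ t and t + σⱼ s are at most Λ + 2⁻ʲ for j ≤ ⌈log₂ 3n⌉, where σⱼ = ⅓ - 2pj
-- stays above ¼, and Λ grows by at most 1/n per layer. That is, Λ - s is at least a fixed fraction of t
-- down to the scale 1/n, which is the room needed to absorb the p-terms. Each layer then adds at most p
-- to the norm of the accepting function, which is therefore at most 1 + n.
module Submission where

open import Defs

module SpectralBound where

  open import Algebra.Bundles using (CommutativeMonoid; CommutativeRing)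
  import Algebra.Properties.CommutativeMonoid.Sum as Sum
  open import Data.Bool using (Bool; true; false; _∧_; _∨_; _xor_; not; if_then_else_; T)
  open import Data.Bool.Properties using (T?; T-∧; T-∨; xor-∧-commutativeRing)
  open import Data.Fin using (Fin; zero; suc)
  open import Data.Fin.Patterns using (0F; 1F; 2F)
  open import Data.Fin.Permutation using (Permutation′; _⟨$⟩ʳ_; _⟨$⟩ˡ_; inverseˡ; flip)
  open import Data.Fin.Properties using (all?)
  open import Data.Fin.Subset using (Subset) renaming (∣_∣ to card)
  import Data.Integer as ℤ
  import Data.Integer.Properties as ℤ
  open import Data.List using (List; []; _∷_; map; _++_; filterᵇ)
  open import Data.List.Membership.Propositional using (_∈_)
  open import Data.List.Membership.Propositional.Properties using (∈-map⁺; ∈-map⁻; ∈-++⁺ˡ; ∈-++⁺ʳ)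
  open import Data.List.Membership.Propositional.Properties.WithK using (unique∧set⇒bag)
  open import Data.List.Properties using (map-++; map-∘; map-cong)
  open import Data.List.Relation.Binary.BagAndSetEquality using (∼bag⇒↭)
  open import Data.List.Relation.Binary.Permutation.Propositional as Perm using (_↭_)
  import Data.List.Relation.Binary.Permutation.Propositional.Properties as Perm
  open import Data.List.Relation.Unary.All as All using (All; []; _∷_)
  open import Data.List.Relation.Unary.AllPairs using ([]; _∷_)
  open import Data.List.Relation.Unary.Any as Any using (Any; any?; here)
  open import Data.List.Relation.Unary.Unique.Propositional using (Unique)
  import Data.List.Relation.Unary.Unique.Propositional.Properties as Unique
  open import Data.Nat as ℕ using (ℕ; zero; suc; z≤n; s≤s; _≡ᵇ_)
  open import Data.Nat.Logarithm using (⌈log₂_⌉; ⌈log₂⌉-mono-≤; ⌈log₂2^n⌉≡n)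
  import Data.Nat.Properties as ℕ
  open import Data.Product using (_×_; _,_; proj₁; proj₂; ∃)
  open import Data.Rational using (ℚ; 0ℚ; 1ℚ; ½; _+_; _*_; _-_; -_; _/_; 1/_; ∣_∣; _≤_; NonZero; Positive; NonNegative; positive; nonNegative; toℚᵘ)
  open import Data.Rational.Properties
  open import Data.Rational.Solver using (module +-*-Solver)
  import Data.Rational.Unnormalised as ℚᵘ
  import Data.Rational.Unnormalised.Properties as ℚᵘ
  open import Data.Sum using (inj₁; inj₂)
  open import Data.Unit using (tt)
  open import Data.Vec using (Vec; []; _∷_; lookup; tabulate; zipWith)
  open import Data.Vec.Properties using (lookup∘tabulate; tabulate∘lookup; tabulate-cong; lookup-zipWith; ∷-injectiveʳ)
  open import Function using (_∘_; Equivalence; mk⇔)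
  open import Relation.Binary.PropositionalEquality
  open import Relation.Nullary using (¬_; yes; no)
  open import Relation.Nullary.Decidable using (Dec; toWitness)
  open import Relation.Nullary.Negation using (contradiction)
  open +-*-Solver using (solve; _:=_; _:+_; _:*_; :-_; _:-_; con)

  -- Order arithmetic in `ℚ` and the embedding of `ℕ`.

  infixr 4 _⟨+⟩_
  _⟨+⟩_ : ∀ {a b} → 0ℚ ≤ a → 0ℚ ≤ b → 0ℚ ≤ a + b
  _⟨+⟩_ = +-mono-≤

  0≤ : ∀ q → .{{_ : NonNegative q}} → 0ℚ ≤ q
  0≤ q = nonNegative⁻¹ q

  0≤* : ∀ {a b} → 0ℚ ≤ a → 0ℚ ≤ b → 0ℚ ≤ a * b
  0≤* {a} {b} 0≤a 0≤b = subst (_≤ a * b) (*-zeroʳ a) (*-monoˡ-≤-nonNeg a {{nonNegative 0≤a}} 0≤b)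

  ≤⇒0≤- : ∀ {a b} → a ≤ b → 0ℚ ≤ b - a
  ≤⇒0≤- {a} {b} a≤b = subst (_≤ b - a) (+-inverseʳ a) (+-monoˡ-≤ (- a) a≤b)

  -- The workhorse of the estimates: the slack `b - a` is displayed as a combination of terms
  -- already known to be nonnegative, and the ring solver checks the identity.
  ≤-from-difference : ∀ {a b d} → 0ℚ ≤ d → b - a ≡ d → a ≤ b
  ≤-from-difference {a} {b} {d} 0≤d eq = subst₂ _≤_ (+-identityˡ a)
    (solve 2 (λ a b → (b :- a) :+ a := b) refl a b)
    (+-monoˡ-≤ a (subst (0ℚ ≤_) (sym eq) 0≤d))

  *-mono : ∀ {c a b} → 0ℚ ≤ c → a ≤ b → c * a ≤ c * b
  *-mono {c} 0≤c = *-monoˡ-≤-nonNeg c {{nonNegative 0≤c}}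

  -- `natℚ` reduces its fraction by a gcd that does not compute on variables, so the identity is
  -- checked on unnormalised fractions and carried back.
  natℚ-+ : ∀ m n → natℚ (m ℕ.+ n) ≡ natℚ m + natℚ n
  natℚ-+ m n = toℚᵘ-injective (begin
    toℚᵘ (natℚ (m ℕ.+ n))             ≈⟨ toℚᵘ-fromℚᵘ (nat (m ℕ.+ n)) ⟩
    nat (m ℕ.+ n)                     ≈⟨ ℚᵘ.*≡* (cong (ℤ._* ℤ.+ 1) (sym (cong₂ ℤ._+_ (ℤ.*-identityʳ (ℤ.+ m)) (ℤ.*-identityʳ (ℤ.+ n))))) ⟩
    nat m ℚᵘ.+ nat n                  ≈⟨ ℚᵘ.+-cong (toℚᵘ-fromℚᵘ (nat m)) (toℚᵘ-fromℚᵘ (nat n)) ⟨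
    toℚᵘ (natℚ m) ℚᵘ.+ toℚᵘ (natℚ n)  ≈⟨ toℚᵘ-homo-+ (natℚ m) (natℚ n) ⟨
    toℚᵘ (natℚ m + natℚ n)            ∎)
    where
    open import Relation.Binary.Reasoning.Setoid ℚᵘ.≃-setoid
    nat : ℕ → ℚᵘ.ℚᵘ
    nat k = ℚᵘ.mkℚᵘ (ℤ.+ k) 0

  natℚ-* : ∀ m n → natℚ (m ℕ.* n) ≡ natℚ m * natℚ n
  natℚ-* zero    n = sym (*-zeroˡ (natℚ n))
  natℚ-* (suc m) n = trans (natℚ-+ n (m ℕ.* n)) (trans (cong (natℚ n +_) (natℚ-* m n))
    (trans (solve 2 (λ a b → b :+ a :* b := (con 1ℚ :+ a) :* b) refl (natℚ m) (natℚ n))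
      (cong (_* natℚ n) (sym (natℚ-+ 1 m)))))

  0≤natℚ : ∀ n → 0ℚ ≤ natℚ n
  0≤natℚ n = nonNegative⁻¹ (natℚ n) {{normalize-nonNeg n 1}}

  natℚ-mono : ∀ {m n} → m ℕ.≤ n → natℚ m ≤ natℚ n
  natℚ-mono {m} {n} m≤n = subst (λ k → natℚ m ≤ natℚ k) (ℕ.m+[n∸m]≡n m≤n)
    (subst (natℚ m ≤_) (sym (natℚ-+ m (n ℕ.∸ m)))
      (≤-from-difference (0≤natℚ (n ℕ.∸ m))
        (solve 2 (λ a b → (a :+ b) :- a := b) refl (natℚ m) (natℚ (n ℕ.∸ m)))))

  0≤half^ : ∀ n → 0ℚ ≤ half^ n
  0≤half^ zero    = nonNegative⁻¹ 1ℚ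
  0≤half^ (suc n) = 0≤* (nonNegative⁻¹ ½) (0≤half^ n)

  -- Constants and the finite combinatorics of one layer.

  infixl 7 _÷_
  _÷_ : ℕ → (d : ℕ) .{{_ : ℕ.NonZero d}} → ℚ
  m ÷ d = ℤ.+ m / d

  ⅓ ¼ 1/24 1/40 2ℚ : ℚ
  ⅓ = 1 ÷ 3
  ¼ = 1 ÷ 4
  1/24 = 1 ÷ 24
  1/40 = 1 ÷ 40
  2ℚ = 2 ÷ 1

  -- The three states of a layer are placed at the points 0F, 1F, 2F of a triangle; short₁, short₂ and
  -- long are the sides 01, 12 and 02.
  data Length : Set where
    none short₁ short₂ long : Length

  _≼_ : Length → Length → Bool
  none   ≼ _      = true
  short₁ ≼ short₁ = true
  short₂ ≼ short₂ = true
  _      ≼ long   = true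
  _      ≼ _      = false

  Pair : Set
  Pair = Length × Length

  _≼₂_ : Pair → Pair → Bool
  (a , b) ≼₂ (c , d) = (a ≼ c ∧ b ≼ d) ∨ (a ≼ d ∧ b ≼ c)

  -- A form stands for the half sum of its first pair plus p times the half sum of its second pair.
  Form : Set
  Form = Pair × Pair

  -- Two states with a common successor position always fit `small`. If their successor positions
  -- are disjoint, then, there being only three points, one of the states has both successors at the
  -- same point. Should the other have two distinct ones, the pair fits `mid` (1F against 0F and
  -- 2F), `B₁` (0F against 1F and 2F) or `B₂` (2F against 0F and 1F); otherwise neither depends on
  -- the bit and `S₁`, `S₂` or `one` fits. `H₁` and `H₂` sharpen `small` when one bit collapses a
  -- short side and the other keeps it.
  S₁ S₂ B₁ B₂ H₁ H₂ mid small one nil : Form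
  S₁    = (short₁ , short₁) , (none , none)
  S₂    = (short₂ , short₂) , (none , none)
  B₁    = (short₁ , long)   , (none , short₂)
  B₂    = (short₂ , long)   , (none , short₁)
  H₁    = (none , short₁)   , (short₁ , short₁)
  H₂    = (none , short₂)   , (short₂ , short₂)
  mid   = (short₁ , short₂) , (short₁ , short₂)
  small = (none , long)     , (long , long)
  one   = (long , long)     , (none , none)
  nil   = (none , none)     , (none , none)

  dist : Fin 3 → Fin 3 → Length
  dist 0F 0F = none
  dist 0F 1F = short₁
  dist 0F 2F = long
  dist 1F 0F = short₁
  dist 1F 1F = none
  dist 1F 2F = short₂
  dist 2F 0F = long
  dist 2F 1F = short₂
  dist 2F 2F = none

  -- States u and v of a layer have successors (u₀, u₁) and (v₀, v₁). Both the average and the half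
  -- difference of the successor functions can be paired in two ways, and either may give the better bound.
  fits : Form → (u₀ u₁ v₀ v₁ : Fin 3) → Bool
  fits (A , B) u₀ u₁ v₀ v₁ =
    ((dist u₀ v₀ , dist u₁ v₁) ≼₂ A ∨ (dist u₀ v₁ , dist u₁ v₀) ≼₂ A) ∧
    ((dist u₀ v₀ , dist v₁ u₁) ≼₂ B ∨ (dist u₀ u₁ , dist v₁ v₀) ≼₂ B)

  three : ∀ {A : Set} → A → A → A → Fin 3 → A
  three a b c 0F = a
  three a b c 1F = b
  three a b c 2F = c

  labelings : List (Fin 3 → Fin 3)
  labelings =
    three 0F 1F 2F ∷ three 0F 2F 1F ∷ three 1F 0F 2F ∷ three 1F 2F 0F ∷ three 2F 0F 1F ∷ three 2F 1F 0F ∷ []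

  -- The critical entry is `(B₁ , H₂)`, with mirror image `(B₂ , H₁)`. It arises when one bit fixes
  -- all three points and the other moves 1F to 2F: side 12 is roughly halved, side 01 moves halfway
  -- to the long side, and the long side stays `one`, so nothing shrinks there.
  shortSides : List (Form × Form)
  shortSides = (mid , small) ∷ (small , small) ∷ (B₁ , H₂) ∷ (B₂ , H₁) ∷ (S₁ , S₂) ∷ (one , nil) ∷ []

  -- By the case distinction on common and disjoint successors, any two states fit one of these
  -- forms; `S₁` and `S₂` are subsumed by `one`.
  longSides : List Form
  longSides = small ∷ B₁ ∷ B₂ ∷ mid ∷ one ∷ []

  side : Form × Form → Form → Length → Form
  side (f , g) h none   = nil
  side (f , g) h short₁ = f
  side (f , g) h short₂ = g
  side (f , g) h long   = h

  Fit : (k₀ k₁ l : Fin 3 → Fin 3) → Form × Form → Form → Set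
  Fit k₀ k₁ l fg h = ∀ u v → T (fits (side fg h (dist (l u) (l v))) (k₀ u) (k₁ u) (k₀ v) (k₁ v))

  -- k₀ and k₁ give the positions of the successors of the three states under the bits 0 and 1.
  Compatible : (k₀ k₁ : Fin 3 → Fin 3) → Set
  Compatible k₀ k₁ = Any (λ l → Any (λ fg → Any (Fit k₀ k₁ l fg) longSides) shortSides) labelings

  compatible? : ∀ k₀ k₁ → Dec (Compatible k₀ k₁)
  compatible? k₀ k₁ = any? (λ l → any? (λ fg → any? (λ h → all? (λ u → all? (λ v → T? _))) longSides) shortSides) labelings

  -- Abstract, so that unification never unfolds the search over the 3⁶ cases.
  abstract
    compatible-exists : ∀ a b c d e f → Compatible (three a b c) (three d e f)
    compatible-exists = toWitness {a? = all? λ a → all? λ b → all? λ c → all? λ d → all? λ e → all? λ f →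
      compatible? (three a b c) (three d e f)} tt

  -- The invariant on the sides of the triangle and its preservation.

  module Analysis (p : ℚ) (J : ℕ) (0≤p : 0ℚ ≤ p) (p≤ : p ≤ 1/40) (pJ : p * natℚ J ≤ 1/24) where

    -- The slope drops by 2p whenever the offset 2⁻ʲ in the constraint line is halved: this pays for the
    -- term p t in B₁ when t is roughly halved to H₂.
    slope : ℕ → ℚ
    slope zero    = ⅓
    slope (suc j) = slope j - (p + p)

    slope-linear : ∀ j → slope j ≡ ⅓ - (p + p) * natℚ j
    slope-linear zero    = solve 1 (λ p → con ⅓ := con ⅓ :- (p :+ p) :* con 0ℚ) refl p
    slope-linear (suc j) = trans (cong (_- (p + p)) (slope-linear j))
      (trans (solve 2 (λ p n → (con ⅓ :- (p :+ p) :* n) :- (p :+ p) := con ⅓ :- (p :+ p) :* (con 1ℚ :+ n)) refl p (natℚ j))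
        (cong (λ n → ⅓ - (p + p) * n) (sym (natℚ-+ 1 j))))

    slope≤⅓ : ∀ j → slope j ≤ ⅓
    slope≤⅓ j = ≤-from-difference (0≤* (0≤p ⟨+⟩ 0≤p) (0≤natℚ j))
      (trans (cong (λ q → ⅓ - q) (slope-linear j))
        (solve 2 (λ p n → con ⅓ :- (con ⅓ :- (p :+ p) :* n) := (p :+ p) :* n) refl p (natℚ j)))

    -- The total loss is `2pJ ≤ 1/12 = ⅓ - ¼`.
    ¼≤slope : ¼ ≤ slope J
    ¼≤slope = ≤-from-difference (0≤* (0≤ 2ℚ) (≤⇒0≤- pJ))
      (trans (cong (_- ¼) (slope-linear J))
        (solve 2 (λ p n → (con ⅓ :- (p :+ p) :* n) :- con ¼ := con 2ℚ :* (con 1/24 :- p :* n)) refl p (natℚ J)))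

    ε : ℚ
    ε = half^ J

    0≤ε : 0ℚ ≤ ε
    0≤ε = 0≤half^ J

    -- A critical layer halves `Λ - s` and `t` alike up to `p`-terms, so their ratio erodes with
    -- each halving. The offset makes constraint `j` bite only while `slope j * t` exceeds
    -- `half^ j`; beyond `j = J` the loss is charged to `Λ`.
    record Below (Λ s t : ℚ) : Set where
      field
        nonneg : 0ℚ ≤ s
        bound  : s ≤ Λ
        line   : ∀ j → j ℕ.≤ J → s + slope j * t ≤ Λ + half^ j

    open Below

    -- No slope exceeds ⅓ and all offsets are nonnegative, so one inequality with slope ⅓ and no
    -- offset implies the whole family.
    below : ∀ {Λ s t} → 0ℚ ≤ s → 0ℚ ≤ t → s + ⅓ * t ≤ Λ → Below Λ s t
    below {Λ} {s} {t} 0≤s 0≤t s+t/3≤Λ = record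
      { nonneg = 0≤s
      ; bound  = ≤-from-difference (≤⇒0≤- s+t/3≤Λ ⟨+⟩ 0≤* (0≤ ⅓) 0≤t)
          (solve 3 (λ Λ s t → Λ :- s := (Λ :- (s :+ con ⅓ :* t)) :+ con ⅓ :* t) refl Λ s t)
      ; line   = λ j _ → ≤-from-difference (≤⇒0≤- s+t/3≤Λ ⟨+⟩ 0≤* (≤⇒0≤- (slope≤⅓ j)) 0≤t ⟨+⟩ 0≤half^ j)
          (solve 5 (λ Λ s t σ h → (Λ :+ h) :- (s :+ σ :* t) :=
              (Λ :- (s :+ con ⅓ :* t)) :+ ((con ⅓ :- σ) :* t :+ h)) refl Λ s t (slope j) (half^ j))
      }

    Admissible : ℚ → ℚ → ℚ → Set
    Admissible Λ s t = Below Λ s t × Below Λ t s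

    swap : ∀ {Λ s t} → Admissible Λ s t → Admissible Λ t s
    swap (b , b′) = b′ , b

    module Forms (Λ s t : ℚ) where

      len : Length → ℚ
      len none   = 0ℚ
      len short₁ = s
      len short₂ = t
      len long   = Λ

      avg : Pair → ℚ
      avg (a , b) = ½ * (len a + len b)

      value : Form → ℚ
      value (A , B) = avg A + p * avg B

    open Forms

    module Step {Λ s t : ℚ} (adm : Admissible Λ s t) (Λ≤2 : Λ ≤ 2ℚ) where

      private
        0≤s = nonneg (proj₁ adm)
        0≤t = nonneg (proj₂ adm)
        s≤Λ = bound (proj₁ adm)
        t≤Λ = bound (proj₂ adm)
        0≤Λ = ≤-trans 0≤s s≤Λ
        Λ′  = Λ + ε
        v   = value Λ s t
        0≤1/40-p = ≤⇒0≤- p≤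

      0≤len : ∀ a → 0ℚ ≤ len Λ s t a
      0≤len none   = ≤-refl
      0≤len short₁ = 0≤s
      0≤len short₂ = 0≤t
      0≤len long   = 0≤Λ

      0≤value : ∀ F → 0ℚ ≤ v F
      0≤value ((a , b) , (c , d)) =
        0≤* (0≤ ½) (0≤len a ⟨+⟩ 0≤len b) ⟨+⟩ 0≤* 0≤p (0≤* (0≤ ½) (0≤len c ⟨+⟩ 0≤len d))

      len-mono : ∀ a b → T (a ≼ b) → len Λ s t a ≤ len Λ s t b
      len-mono none   b      _ = 0≤len b
      len-mono short₁ short₁ _ = ≤-refl
      len-mono short₁ long   _ = s≤Λ
      len-mono short₂ short₂ _ = ≤-refl
      len-mono short₂ long   _ = t≤Λ
      len-mono long   long   _ = ≤-refl

      len≤ : ∀ a → len Λ s t a ≤ Λ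
      len≤ none   = 0≤Λ
      len≤ short₁ = s≤Λ
      len≤ short₂ = t≤Λ
      len≤ long   = ≤-refl

      avg-mono : ∀ A B → T (A ≼₂ B) → avg Λ s t A ≤ avg Λ s t B
      avg-mono (a , b) (c , d) le with Equivalence.to (T-∨ {a ≼ c ∧ b ≼ d}) le
      ... | inj₁ le′ with a≼c , b≼d ← Equivalence.to T-∧ le′ =
        *-mono (0≤ ½) (+-mono-≤ (len-mono a c a≼c) (len-mono b d b≼d))
      ... | inj₂ le′ with a≼d , b≼c ← Equivalence.to T-∧ le′ =
        *-mono (0≤ ½) (subst (_ ≤_) (+-comm (len Λ s t d) (len Λ s t c)) (+-mono-≤ (len-mono a d a≼d) (len-mono b c b≼c)))

      -- The jth constraint follows from the (j-1)st one, and the 0th is vacuous. The Jth gives B₁ ≤ Λ + ε,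
      -- which is why Λ has to grow by ε.
      contract : Admissible Λ′ (v B₁) (v H₂)
      contract = record
          { nonneg = 0≤value B₁
          ; bound  = B₁≤Λ′
          ; line   = λ { zero _ → line₀ ; (suc j) j<J → lineₛ j (ℕ.<⇒≤ j<J) }
          }
        , below (0≤value H₂) (0≤value B₁)
            (≤-from-difference (0≤* (0≤ ⅓) (≤⇒0≤- B₁≤Λ′) ⟨+⟩ 0≤* (0≤ (2 ÷ 3)) (≤⇒0≤- t≤Λ ⟨+⟩ 0≤ε) ⟨+⟩
                  0≤* 0≤t (0≤1/40-p ⟨+⟩ 0≤ (17 ÷ 120)))
              (solve 5 (λ Λ s t p ε →
                let B = con ½ :* (s :+ Λ) :+ p :* (con ½ :* (con 0ℚ :+ t))
                    H = con ½ :* (con 0ℚ :+ t) :+ p :* (con ½ :* (t :+ t)) in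
                (Λ :+ ε) :- (H :+ con ⅓ :* B) :=
                con ⅓ :* ((Λ :+ ε) :- B) :+ (con (2 ÷ 3) :* ((Λ :- t) :+ ε) :+
                  t :* ((con 1/40 :- p) :+ con (17 ÷ 120)))) refl Λ s t p ε))
        where
        B₁≤Λ′ : v B₁ ≤ Λ′
        B₁≤Λ′ = ≤-from-difference (0≤* (0≤ ½) (≤⇒0≤- (line (proj₁ adm) J ℕ.≤-refl)) ⟨+⟩
                     0≤* (0≤ ½) (0≤* (≤⇒0≤- ¼≤slope ⟨+⟩ 0≤1/40-p ⟨+⟩ 0≤ (9 ÷ 40)) 0≤t ⟨+⟩ 0≤ε))
          (solve 6 (λ Λ s t p ε σ →
            (Λ :+ ε) :- (con ½ :* (s :+ Λ) :+ p :* (con ½ :* (con 0ℚ :+ t))) :=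
            con ½ :* ((Λ :+ ε) :- (s :+ σ :* t)) :+
            con ½ :* (((σ :- con ¼) :+ ((con 1/40 :- p) :+ con (9 ÷ 40))) :* t :+ ε)) refl Λ s t p ε (slope J))

        -- Here `Λ ≤ 2` enters: it gives `t ≤ 2`, so the offset 1 covers every term in `t`.
        line₀ : v B₁ + slope 0 * v H₂ ≤ Λ′ + half^ 0
        line₀ = ≤-from-difference (0≤* (0≤ ½) (≤⇒0≤- s≤Λ) ⟨+⟩ 0≤* (0≤ ½) (≤⇒0≤- Λ≤2 ⟨+⟩ ≤⇒0≤- t≤Λ) ⟨+⟩
                     0≤* 0≤t (0≤* (0≤ (5 ÷ 6)) (0≤1/40-p ⟨+⟩ 0≤ (3 ÷ 8))) ⟨+⟩ 0≤ε)
          (solve 5 (λ Λ s t p ε →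
                let B = con ½ :* (s :+ Λ) :+ p :* (con ½ :* (con 0ℚ :+ t))
                    H = con ½ :* (con 0ℚ :+ t) :+ p :* (con ½ :* (t :+ t)) in
            ((Λ :+ ε) :+ con 1ℚ) :- (B :+ con ⅓ :* H) :=
            con ½ :* (Λ :- s) :+ (con ½ :* ((con 2ℚ :- Λ) :+ (Λ :- t)) :+
              (t :* (con (5 ÷ 6) :* ((con 1/40 :- p) :+ con (3 ÷ 8))) :+ ε))) refl Λ s t p ε)

        -- Half of constraint `j` accounts for all terms free of `p`. What remains is
        -- `p t (slope j - ½ - 2p)`, which is at most 0 because `slope j ≤ ⅓`.
        lineₛ : ∀ j → j ℕ.≤ J → v B₁ + slope (suc j) * v H₂ ≤ Λ′ + half^ (suc j)
        lineₛ j j≤J = ≤-from-difference (0≤* (0≤ ½) (≤⇒0≤- (line (proj₁ adm) j j≤J)) ⟨+⟩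
                       0≤* (0≤* 0≤p 0≤t) (≤⇒0≤- (slope≤⅓ j) ⟨+⟩ 0≤ (1 ÷ 6) ⟨+⟩ 0≤p ⟨+⟩ 0≤p) ⟨+⟩ 0≤ε)
          (solve 7 (λ Λ s t p ε σ h →
                let B = con ½ :* (s :+ Λ) :+ p :* (con ½ :* (con 0ℚ :+ t))
                    H = con ½ :* (con 0ℚ :+ t) :+ p :* (con ½ :* (t :+ t)) in
            ((Λ :+ ε) :+ con ½ :* h) :- (B :+ (σ :- (p :+ p)) :* H) :=
            con ½ :* ((Λ :+ h) :- (s :+ σ :* t)) :+
            (p :* t :* ((con ⅓ :- σ) :+ (con (1 ÷ 6) :+ (p :+ p))) :+ ε)) refl Λ s t p ε (slope j) (half^ j))

      kept : Admissible Λ′ (v S₁) (v S₂)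
      kept = shrink (proj₁ adm) , subst₂ (Below Λ′) (sym (same t)) (sym (same s)) (weaken (proj₂ adm))
        where
        same : ∀ a → ½ * (a + a) + p * (½ * (0ℚ + 0ℚ)) ≡ a
        same a = solve 2 (λ a p → con ½ :* (a :+ a) :+ p :* (con ½ :* (con 0ℚ :+ con 0ℚ)) := a) refl a p
        weaken : ∀ {a b} → Below Λ a b → Below Λ′ a b
        weaken {a} {b} β = record
          { nonneg = nonneg β
          ; bound  = ≤-trans (bound β) (≤-from-difference 0≤ε (solve 2 (λ Λ ε → (Λ :+ ε) :- Λ := ε) refl Λ ε))
          ; line   = λ j j≤J → ≤-trans (line β j j≤J)
              (≤-from-difference 0≤ε (solve 3 (λ Λ ε h → ((Λ :+ ε) :+ h) :- (Λ :+ h) := ε) refl Λ ε (half^ j)))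
          }
        shrink : Below Λ s t → Below Λ′ (v S₁) (v S₂)
        shrink β = subst₂ (Below Λ′) (sym (same s)) (sym (same t)) (weaken β)

      -- Adding the `J`th constraints of both sides and using `¼ ≤ slope J` yields
      -- `s + t ≤ 8/5 (Λ + ε)`; hence the factor `2/5 = ½ / (1 + ¼)`. The coefficient of `Λ` then
      -- requires `29/30 + 17/15 p ≤ 1`, that is `p ≤ 1/34`, the tightest condition on `p` among
      -- these forms.
      balanced : Admissible Λ′ (v mid) (v small)
      balanced =
          below (0≤value mid) (0≤value small)
            (≤-from-difference (0≤* (0≤* (0≤ (2 ÷ 5)) (0≤ 1ℚ ⟨+⟩ 0≤p))
                    ((≤⇒0≤- (line (proj₁ adm) J ℕ.≤-refl) ⟨+⟩ ≤⇒0≤- (line (proj₂ adm) J ℕ.≤-refl)) ⟨+⟩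
                     0≤* (≤⇒0≤- ¼≤slope) (0≤s ⟨+⟩ 0≤t)) ⟨+⟩
                  0≤* 0≤Λ (0≤* (0≤ (17 ÷ 15)) (0≤1/40-p ⟨+⟩ 0≤ (3 ÷ 680))) ⟨+⟩
                  0≤* 0≤ε (0≤* (0≤ (4 ÷ 5)) (0≤1/40-p ⟨+⟩ 0≤ (9 ÷ 40))))
              (solve 6 (λ Λ s t p ε σ →
                let M = con ½ :* (s :+ t) :+ p :* (con ½ :* (s :+ t))
                    Q = con ½ :* (con 0ℚ :+ Λ) :+ p :* (con ½ :* (Λ :+ Λ)) in
                (Λ :+ ε) :- (M :+ con ⅓ :* Q) :=
                con (2 ÷ 5) :* (con 1ℚ :+ p) :*
                  ((((Λ :+ ε) :- (s :+ σ :* t)) :+ ((Λ :+ ε) :- (t :+ σ :* s))) :+ (σ :- con ¼) :* (s :+ t)) :+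
                (Λ :* (con (17 ÷ 15) :* ((con 1/40 :- p) :+ con (3 ÷ 680))) :+
                 ε :* (con (4 ÷ 5) :* ((con 1/40 :- p) :+ con (9 ÷ 40))))) refl Λ s t p ε (slope J)))
        , below (0≤value small) (0≤value mid)
            (≤-from-difference (0≤* (0≤* (0≤ (1 ÷ 6)) (0≤ 1ℚ ⟨+⟩ 0≤p)) (≤⇒0≤- s≤Λ ⟨+⟩ ≤⇒0≤- t≤Λ) ⟨+⟩
                  0≤* 0≤Λ (0≤* (0≤ (4 ÷ 3)) (0≤1/40-p ⟨+⟩ 0≤ (1 ÷ 10))) ⟨+⟩ 0≤ε)
              (solve 5 (λ Λ s t p ε →
                let M = con ½ :* (s :+ t) :+ p :* (con ½ :* (s :+ t))
                    Q = con ½ :* (con 0ℚ :+ Λ) :+ p :* (con ½ :* (Λ :+ Λ)) in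
                (Λ :+ ε) :- (Q :+ con ⅓ :* M) :=
                con (1 ÷ 6) :* (con 1ℚ :+ p) :* ((Λ :- s) :+ (Λ :- t)) :+
                (Λ :* (con (4 ÷ 3) :* ((con 1/40 :- p) :+ con (1 ÷ 10))) :+ ε)) refl Λ s t p ε))

      halved : Admissible Λ′ (v small) (v small)
      halved = β , β
        where
        β = below (0≤value small) (0≤value small)
            (≤-from-difference (0≤* 0≤Λ (0≤* (0≤ (4 ÷ 3)) (0≤1/40-p ⟨+⟩ 0≤ (9 ÷ 40))) ⟨+⟩ 0≤ε)
              (solve 3 (λ Λ p ε →
                let Q = con ½ :* (con 0ℚ :+ Λ) :+ p :* (con ½ :* (Λ :+ Λ)) in
                (Λ :+ ε) :- (Q :+ con ⅓ :* Q) :=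
                Λ :* (con (4 ÷ 3) :* ((con 1/40 :- p) :+ con (9 ÷ 40))) :+ ε) refl Λ p ε))

      merged : Admissible Λ′ (v one) (v nil)
      merged =
          below (0≤value one) (0≤value nil)
            (≤-from-difference 0≤ε (solve 3 (λ Λ p ε →
                let O = con ½ :* (Λ :+ Λ) :+ p :* (con ½ :* (con 0ℚ :+ con 0ℚ))
                    N = con ½ :* (con 0ℚ :+ con 0ℚ) :+ p :* (con ½ :* (con 0ℚ :+ con 0ℚ)) in
                (Λ :+ ε) :- (O :+ con ⅓ :* N) := ε) refl Λ p ε))
        , below (0≤value nil) (0≤value one)
            (≤-from-difference (0≤* (0≤ (2 ÷ 3)) 0≤Λ ⟨+⟩ 0≤ε) (solve 3 (λ Λ p ε →
                let O = con ½ :* (Λ :+ Λ) :+ p :* (con ½ :* (con 0ℚ :+ con 0ℚ))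
                    N = con ½ :* (con 0ℚ :+ con 0ℚ) :+ p :* (con ½ :* (con 0ℚ :+ con 0ℚ)) in
                (Λ :+ ε) :- (N :+ con ⅓ :* O) := con (2 ÷ 3) :* Λ :+ ε) refl Λ p ε))

  -- The weighted spectral norm, by recursion on the first bit.

  even odd : ∀ {n} → (Vec Bool (suc n) → ℚ) → Vec Bool n → ℚ
  even g x = ½ * (g (false ∷ x) + g (true ∷ x))
  odd  g x = ½ * (g (false ∷ x) - g (true ∷ x))

  module Norm (p : ℚ) (0≤p : 0ℚ ≤ p) where

    norm : ∀ {n} → (Vec Bool n → ℚ) → ℚ
    norm {zero}  g = ∣ g [] ∣
    norm {suc n} g = norm (even g) + p * norm (odd g)

    norm-cong : ∀ {n} {g h : Vec Bool n → ℚ} → (∀ x → g x ≡ h x) → norm g ≡ norm h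
    norm-cong {zero}  eq = cong ∣_∣ (eq [])
    norm-cong {suc n} eq = cong₂ (λ a b → a + p * b)
      (norm-cong λ x → cong₂ (λ a b → ½ * (a + b)) (eq (false ∷ x)) (eq (true ∷ x)))
      (norm-cong λ x → cong₂ (λ a b → ½ * (a - b)) (eq (false ∷ x)) (eq (true ∷ x)))

    norm-+ : ∀ {n} (g h : Vec Bool n → ℚ) → norm (λ x → g x + h x) ≤ norm g + norm h
    norm-+ {zero}  g h = ∣p+q∣≤∣p∣+∣q∣ (g []) (h [])
    norm-+ {suc n} g h = subst₂ _≤_
      (cong₂ (λ a b → a + p * b)
        (norm-cong λ x → solve 4 (λ a b c d → con ½ :* (a :+ b) :+ con ½ :* (c :+ d) := con ½ :* ((a :+ c) :+ (b :+ d)))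
          refl (g (false ∷ x)) (g (true ∷ x)) (h (false ∷ x)) (h (true ∷ x)))
        (norm-cong λ x → solve 4 (λ a b c d → con ½ :* (a :- b) :+ con ½ :* (c :- d) := con ½ :* ((a :+ c) :- (b :+ d)))
          refl (g (false ∷ x)) (g (true ∷ x)) (h (false ∷ x)) (h (true ∷ x))))
      (solve 5 (λ a b c d p → (a :+ b) :+ p :* (c :+ d) := (a :+ p :* c) :+ (b :+ p :* d)) refl
        (norm (even g)) (norm (even h)) (norm (odd g)) (norm (odd h)) p)
      (+-mono-≤ (norm-+ (even g) (even h)) (*-mono 0≤p (norm-+ (odd g) (odd h))))

    norm-½ : ∀ {n} (g : Vec Bool n → ℚ) → norm (λ x → ½ * g x) ≡ ½ * norm g
    norm-½ {zero}  g = ∣p*q∣≡∣p∣*∣q∣ ½ (g [])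
    norm-½ {suc n} g = trans
      (cong₂ (λ a b → a + p * b)
        (trans (norm-cong λ x → solve 2 (λ a b → con ½ :* (con ½ :* a :+ con ½ :* b) := con ½ :* (con ½ :* (a :+ b)))
          refl (g (false ∷ x)) (g (true ∷ x))) (norm-½ (even g)))
        (trans (norm-cong λ x → solve 2 (λ a b → con ½ :* (con ½ :* a :- con ½ :* b) := con ½ :* (con ½ :* (a :- b)))
          refl (g (false ∷ x)) (g (true ∷ x))) (norm-½ (odd g))))
      (solve 3 (λ a b p → con ½ :* a :+ p :* (con ½ :* b) := con ½ :* (a :+ p :* b)) refl (norm (even g)) (norm (odd g)) p)

    norm-avg : ∀ {n} (g h : Vec Bool n → ℚ) → norm (λ x → ½ * (g x + h x)) ≤ ½ * (norm g + norm h)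
    norm-avg g h = subst (_≤ ½ * (norm g + norm h)) (sym (norm-½ λ x → g x + h x)) (*-mono (0≤ ½) (norm-+ g h))

    spread : ∀ {n} → (Fin 3 → Vec Bool n → ℚ) → Fin 3 → Fin 3 → ℚ
    spread f u v = norm (λ x → f u x - f v x)

    spread-avg : ∀ {n} (f : Fin 3 → Vec Bool n → ℚ) {g : Vec Bool n → ℚ} a b c d →
      (∀ x → g x ≡ ½ * ((f a x - f b x) + (f c x - f d x))) → norm g ≤ ½ * (spread f a b + spread f c d)
    spread-avg f a b c d eq = subst (_≤ ½ * (spread f a b + spread f c d)) (sym (norm-cong eq))
      (norm-avg (λ x → f a x - f b x) (λ x → f c x - f d x))

  -- Induction over the layers, from the last one backwards.

  module Layer (p : ℚ) (J : ℕ) (0≤p : 0ℚ ≤ p) (p≤ : p ≤ 1/40) (pJ : p * natℚ J ≤ 1/24) where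
    open Analysis p J 0≤p p≤ pJ
    open Norm p 0≤p
    open Forms
    open Below

    record Region (Λ : ℚ) (D : Fin 3 → Fin 3 → ℚ) : Set where
      field
        {s t}      : ℚ
        admissible : Admissible Λ s t
        label      : Fin 3 → Fin 3
        spread≤    : ∀ u v → D u v ≤ len Λ s t (dist (label u) (label v))

    -- The finite search ranges over tables of values; this transfers its outcome pointwise to the
    -- actual successor maps.
    three-η : ∀ {A : Set} (k : Fin 3 → A) u → three (k 0F) (k 1F) (k 2F) u ≡ k u
    three-η k 0F = refl
    three-η k 1F = refl
    three-η k 2F = refl

    module _ {n} {Λ : ℚ} (Λ≤2 : Λ ≤ 2ℚ) (f : Fin 3 → Vec Bool n → ℚ) (τ : Fin 3 → Bool → Fin 3)
      (f′ : Fin 3 → Vec Bool (suc n) → ℚ) (f′-step : ∀ u b x → f′ u (b ∷ x) ≡ f (τ u b) x)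
      (reg : Region Λ (spread f)) where

      open Region reg
      open Step admissible Λ≤2

      private
        k₀ k₁ : Fin 3 → Fin 3
        k₀ u = label (τ u false)
        k₁ u = label (τ u true)

        Λ′ = Λ + ε

      avg-spread : ∀ {g : Vec Bool n → ℚ} a b c d A →
        (∀ x → g x ≡ ½ * ((f a x - f b x) + (f c x - f d x))) →
        T ((dist (label a) (label b) , dist (label c) (label d)) ≼₂ A) → norm g ≤ avg Λ s t A
      avg-spread a b c d A eq le = ≤-trans (spread-avg f a b c d eq)
        (≤-trans (*-mono (0≤ ½) (+-mono-≤ (spread≤ a b) (spread≤ c d))) (avg-mono (dist (label a) (label b) , dist (label c) (label d)) A le))

      even-diff : ∀ u v x → even (λ y → f′ u y - f′ v y) x ≡
        ½ * ((f (τ u false) x - f (τ v false) x) + (f (τ u true) x - f (τ v true) x))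
      even-diff u v x = cong₂ (λ a b → ½ * (a + b))
        (cong₂ _-_ (f′-step u false x) (f′-step v false x))
        (cong₂ _-_ (f′-step u true x) (f′-step v true x))

      odd-diff : ∀ u v x → odd (λ y → f′ u y - f′ v y) x ≡
        ½ * ((f (τ u false) x - f (τ v false) x) - (f (τ u true) x - f (τ v true) x))
      odd-diff u v x = cong₂ (λ a b → ½ * (a - b))
        (cong₂ _-_ (f′-step u false x) (f′-step v false x))
        (cong₂ _-_ (f′-step u true x) (f′-step v true x))

      -- The even part can be grouped as `u₀ - v₀`, `u₁ - v₁` or as `u₀ - v₁`, `u₁ - v₀`; the odd
      -- part as `u₀ - v₀`, `v₁ - u₁` or as `u₀ - u₁`, `v₁ - v₀`. These are the alternatives tested
      -- by `fits`.
      fits-sound : ∀ F u v → T (fits F (k₀ u) (k₁ u) (k₀ v) (k₁ v)) → spread f′ u v ≤ value Λ s t F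
      fits-sound (A , B) u v ok with ok₀ , ok₁ ← Equivalence.to T-∧ ok =
        +-mono-≤ (even-bound (Equivalence.to T-∨ ok₀)) (*-mono 0≤p (odd-bound (Equivalence.to T-∨ ok₁)))
        where
        u₀ = τ u false
        u₁ = τ u true
        v₀ = τ v false
        v₁ = τ v true
        even-bound : _ → norm (even (λ y → f′ u y - f′ v y)) ≤ avg Λ s t A
        even-bound (inj₁ le) = avg-spread u₀ v₀ u₁ v₁ A (even-diff u v) le
        even-bound (inj₂ le) = avg-spread u₀ v₁ u₁ v₀ A
          (λ x → trans (even-diff u v x) (solve 4 (λ a b c d → con ½ :* ((a :- b) :+ (c :- d)) := con ½ :* ((a :- d) :+ (c :- b)))
            refl (f u₀ x) (f v₀ x) (f u₁ x) (f v₁ x))) le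
        odd-bound : _ → norm (odd (λ y → f′ u y - f′ v y)) ≤ avg Λ s t B
        odd-bound (inj₁ le) = avg-spread u₀ v₀ v₁ u₁ B
          (λ x → trans (odd-diff u v x) (solve 4 (λ a b c d → con ½ :* ((a :- b) :- (c :- d)) := con ½ :* ((a :- b) :+ (d :- c)))
            refl (f u₀ x) (f v₀ x) (f u₁ x) (f v₁ x))) le
        odd-bound (inj₂ le) = avg-spread u₀ u₁ v₁ v₀ B
          (λ x → trans (odd-diff u v x) (solve 4 (λ a b c d → con ½ :* ((a :- b) :- (c :- d)) := con ½ :* ((a :- c) :+ (d :- b)))
            refl (f u₀ x) (f v₀ x) (f u₁ x) (f v₁ x))) le

      -- The entries follow the order of `shortSides`. Exchanging `s` and `t` turns `(B₁ , H₂)` into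
      -- `(B₂ , H₁)`, so `contract` serves for both.
      shortSides-admissible : All (λ (F , G) → Admissible Λ′ (value Λ s t F) (value Λ s t G)) shortSides
      shortSides-admissible = balanced ∷ halved ∷ contract ∷ Step.contract (swap admissible) Λ≤2 ∷ kept ∷ merged ∷ []

      longSides-bounded : All (λ F → value Λ s t F ≤ Λ′) longSides
      longSides-bounded = bound (proj₁ halved) ∷ bound (proj₁ contract) ∷ bound (proj₁ (Step.contract (swap admissible) Λ≤2))
        ∷ bound (proj₁ balanced) ∷ bound (proj₁ merged) ∷ []

      region-step : Region Λ′ (spread f′)
      region-step = from-labels (Any.satisfied (compatible-exists (k₀ 0F) (k₀ 1F) (k₀ 2F) (k₁ 0F) (k₁ 1F) (k₁ 2F)))
        where
        k₀′ = three (k₀ 0F) (k₀ 1F) (k₀ 2F)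
        k₁′ = three (k₁ 0F) (k₁ 1F) (k₁ 2F)
        nil≡0 : value Λ s t nil ≡ 0ℚ
        nil≡0 = solve 1 (λ p → con ½ :* (con 0ℚ :+ con 0ℚ) :+ p :* (con ½ :* (con 0ℚ :+ con 0ℚ)) := con 0ℚ) refl p
        side≤ : ∀ F G H → value Λ s t H ≤ Λ′ → ∀ d →
          value Λ s t (side (F , G) H d) ≤ len Λ′ (value Λ s t F) (value Λ s t G) d
        side≤ F G H H≤Λ′ none   = ≤-reflexive nil≡0
        side≤ F G H H≤Λ′ short₁ = ≤-refl
        side≤ F G H H≤Λ′ short₂ = ≤-refl
        side≤ F G H H≤Λ′ long   = H≤Λ′
        from-sides : ∀ l F G H → Admissible Λ′ (value Λ s t F) (value Λ s t G) → value Λ s t H ≤ Λ′ →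
          Fit k₀′ k₁′ l (F , G) H → Region Λ′ (spread f′)
        from-sides l F G H adm H≤Λ′ fit = record
          { admissible = adm
          ; label      = l
          ; spread≤    = λ u v → ≤-trans
              (fits-sound (side (F , G) H (dist (l u) (l v))) u v
                (subst₂ T′ (cong₂ _,_ (three-η k₀ u) (three-η k₁ u)) (cong₂ _,_ (three-η k₀ v) (three-η k₁ v)) (fit u v)))
              (side≤ F G H H≤Λ′ (dist (l u) (l v)))
          }
          where
          T′ : ∀ {F} → Fin 3 × Fin 3 → Fin 3 × Fin 3 → Set
          T′ {F} (a , b) (c , d) = T (fits F a b c d)
        from-labels : ∃ (λ l → Any (λ FG → Any (Fit k₀′ k₁′ l FG) longSides) shortSides) → Region Λ′ (spread f′)
        from-labels (l , any) =
          let adm , any′ = All.lookupAny shortSides-admissible any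
              H≤Λ′ , fit = All.lookupAny longSides-bounded any′
          in from-sides l _ _ _ adm H≤Λ′ fit

    scale : ℕ → ℚ
    scale n = 1ℚ + natℚ n * ε

    scale-suc : ∀ n → scale n + ε ≡ scale (suc n)
    scale-suc n = trans (solve 2 (λ n ε → (con 1ℚ :+ n :* ε) :+ ε := con 1ℚ :+ (con 1ℚ :+ n) :* ε) refl (natℚ n) ε)
      (cong (λ m → 1ℚ + m * ε) (sym (natℚ-+ 1 n)))

    scale-mono : ∀ {m n} → m ℕ.≤ n → scale m ≤ scale n
    scale-mono m≤n = +-monoʳ-≤ 1ℚ (*-monoʳ-≤-nonNeg ε {{nonNegative 0≤ε}} (natℚ-mono m≤n))

    accepts : ∀ {n} → (Fin 3 → Bool) → (Fin n → Fin 3 → Bool → Fin 3) → Fin 3 → Vec Bool n → ℚ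
    accepts A T u x = b2q (A (runFrom T u x))

    region : ∀ n A (T : Fin n → Fin 3 → Bool → Fin 3) → scale n ≤ 2ℚ → Region (scale n) (spread (accepts A T))
    region zero A T _ = record
      { admissible = trivial , trivial
      -- Accepting and rejecting states sit at the two ends of the long side, of length 1. No state
      -- sits at 1F, so both short sides may be 0.
      ; label      = λ u → if A u then 0F else 2F
      ; spread≤    = λ u v → base (A u) (A v)
      }
      where
      1≤ : 1ℚ ≤ scale 0
      1≤ = ≤-reflexive (solve 1 (λ ε → con 1ℚ := con 1ℚ :+ con 0ℚ :* ε) refl ε)
      trivial : Below (scale 0) 0ℚ 0ℚ
      trivial = below ≤-refl ≤-refl (≤-trans (0≤ 1ℚ) 1≤)
      base : ∀ a b → ∣ b2q a - b2q b ∣ ≤ len (scale 0) 0ℚ 0ℚ (dist (if a then 0F else 2F) (if b then 0F else 2F))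
      base = λ
        { false false → ≤-refl
        ; false true  → 1≤
        ; true  false → 1≤
        ; true  true  → ≤-refl
        }
    region (suc n) A T scale≤2 = subst (λ Λ → Region Λ (spread (accepts A T))) (scale-suc n)
      (region-step scale≤2′ (accepts A (T ∘ suc)) (T zero) (accepts A T) (λ _ _ _ → refl) (region n A (T ∘ suc) scale≤2′))
      where
      scale≤2′ = ≤-trans (scale-mono (ℕ.n≤1+n n)) scale≤2

    norm-accepts : ∀ n A (T : Fin n → Fin 3 → Bool → Fin 3) → scale n ≤ 2ℚ → ∀ u → norm (accepts A T u) ≤ 1ℚ + natℚ n
    norm-accepts zero    A T _ u = b2q≤ (A u)
      where
      b2q≤ : ∀ b → ∣ b2q b ∣ ≤ 1ℚ
      b2q≤ false = 0≤ 1ℚ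
      b2q≤ true  = ≤-refl
    norm-accepts (suc n) A T scale≤2 u = subst (norm (accepts A T u) ≤_) total
      (+-mono-≤
        (≤-trans (norm-avg (f u₀) (f u₁)) (*-mono (0≤ ½) (+-mono-≤ (norm-accepts n A (T ∘ suc) scale≤2′ u₀) (norm-accepts n A (T ∘ suc) scale≤2′ u₁))))
        -- The `p`-term is at most `p * (½ * 2)`. Rounding it up to 1 is affordable, since `1 + n`
        -- stays below `8n²`.
        (≤-trans (*-mono 0≤p (≤-trans (≤-reflexive (norm-½ (λ x → f u₀ x - f u₁ x))) (*-mono (0≤ ½) spread≤2))) p≤1))
      where
      f = accepts A (T ∘ suc)
      u₀ = T zero u false
      u₁ = T zero u true
      scale≤2′ = ≤-trans (scale-mono (ℕ.n≤1+n n)) scale≤2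
      open Region (region n A (T ∘ suc) scale≤2′)
      open Step admissible scale≤2′ using (len≤)
      spread≤2 : spread f u₀ u₁ ≤ 2ℚ
      spread≤2 = ≤-trans (spread≤ u₀ u₁) (≤-trans (len≤ (dist (label u₀) (label u₁))) scale≤2′)
      p≤1 : p * (½ * 2ℚ) ≤ 1ℚ
      p≤1 = ≤-from-difference (≤⇒0≤- p≤ ⟨+⟩ 0≤ (39 ÷ 40)) (solve 1 (λ p → con 1ℚ :- p :* (con ½ :* con 2ℚ) := (con 1/40 :- p) :+ con (39 ÷ 40)) refl p)
      total : ½ * ((1ℚ + natℚ n) + (1ℚ + natℚ n)) + 1ℚ ≡ 1ℚ + natℚ (suc n)
      total = trans (solve 1 (λ n → con ½ :* ((con 1ℚ :+ n) :+ (con 1ℚ :+ n)) :+ con 1ℚ := con 1ℚ :+ (con 1ℚ :+ n)) refl (natℚ n))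
        (cong (1ℚ +_) (sym (natℚ-+ 1 n)))

  -- Sums over the cube and Fourier coefficients.

  sumℚ-++ : ∀ xs ys → sumℚ (xs ++ ys) ≡ sumℚ xs + sumℚ ys
  sumℚ-++ []       ys = sym (+-identityˡ (sumℚ ys))
  sumℚ-++ (x ∷ xs) ys = trans (cong (x +_) (sumℚ-++ xs ys)) (sym (+-assoc x (sumℚ xs) (sumℚ ys)))

  sumℚ-↭ : ∀ {xs ys} → xs ↭ ys → sumℚ xs ≡ sumℚ ys
  sumℚ-↭ Perm.refl           = refl
  sumℚ-↭ (Perm.prep x p)     = cong (x +_) (sumℚ-↭ p)
  sumℚ-↭ (Perm.swap {xs} {ys} x y p) = trans (cong (λ q → x + (y + q)) (sumℚ-↭ p))
    (solve 3 (λ x y z → x :+ (y :+ z) := y :+ (x :+ z)) refl x y (sumℚ ys))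
  sumℚ-↭ (Perm.trans p q)    = trans (sumℚ-↭ p) (sumℚ-↭ q)

  ∑ : ∀ {n} → (Vec Bool n → ℚ) → ℚ
  ∑ {n} g = sumℚ (map g (allBits n))

  ∑-cong : ∀ {n} {g h : Vec Bool n → ℚ} → (∀ x → g x ≡ h x) → ∑ g ≡ ∑ h
  ∑-cong {n} eq = cong sumℚ (map-cong eq (allBits n))

  ∑-suc : ∀ {n} (g : Vec Bool (suc n) → ℚ) → ∑ g ≡ ∑ (g ∘ (false ∷_)) + ∑ (g ∘ (true ∷_))
  ∑-suc {n} g = begin
    sumℚ (map g (map (false ∷_) (allBits n) ++ map (true ∷_) (allBits n)))
      ≡⟨ cong sumℚ (map-++ g (map (false ∷_) (allBits n)) _) ⟩
    sumℚ (map g (map (false ∷_) (allBits n)) ++ map g (map (true ∷_) (allBits n)))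
      ≡⟨ sumℚ-++ (map g (map (false ∷_) (allBits n))) _ ⟩
    sumℚ (map g (map (false ∷_) (allBits n))) + sumℚ (map g (map (true ∷_) (allBits n)))
      ≡⟨ cong₂ (λ a b → sumℚ a + sumℚ b) (sym (map-∘ (allBits n))) (sym (map-∘ (allBits n))) ⟩
    ∑ (g ∘ (false ∷_)) + ∑ (g ∘ (true ∷_)) ∎
    where open ≡-Reasoning

  ∑-+ : ∀ {n} (g h : Vec Bool n → ℚ) → ∑ (λ x → g x + h x) ≡ ∑ g + ∑ h
  ∑-+ {n} g h = go (allBits n)
    where
    go : ∀ xs → sumℚ (map (λ x → g x + h x) xs) ≡ sumℚ (map g xs) + sumℚ (map h xs)
    go []       = refl
    go (x ∷ xs) = trans (cong ((g x + h x) +_) (go xs))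
      (solve 4 (λ a b c d → (a :+ b) :+ (c :+ d) := (a :+ c) :+ (b :+ d)) refl (g x) (h x) (sumℚ (map g xs)) (sumℚ (map h xs)))

  ∑-* : ∀ {n} c (g : Vec Bool n → ℚ) → ∑ (λ x → c * g x) ≡ c * ∑ g
  ∑-* {n} c g = go (allBits n)
    where
    go : ∀ xs → sumℚ (map (λ x → c * g x) xs) ≡ c * sumℚ (map g xs)
    go []       = sym (*-zeroʳ c)
    go (x ∷ xs) = trans (cong ((c * g x) +_) (go xs)) (sym (*-distribˡ-+ c (g x) (sumℚ (map g xs))))

  -- Rational values are allowed because `even` and `odd` leave the Boolean functions; `fourier f`
  -- is `fourierℚ (b2q ∘ f)` by definition.
  fourierℚ : ∀ {n} → (Vec Bool n → ℚ) → Subset n → ℚ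
  fourierℚ {n} g s = half^ n * ∑ (λ x → g x * chi s x)

  fourierℚ-split : ∀ {n} (g : Vec Bool (suc n) → ℚ) (h : Vec Bool n → ℚ) b s →
    (∀ x → ½ * (g (false ∷ x) * chi (b ∷ s) (false ∷ x) + g (true ∷ x) * chi (b ∷ s) (true ∷ x)) ≡ h x * chi s x) →
    fourierℚ g (b ∷ s) ≡ fourierℚ h s
  fourierℚ-split {n} g h b s eq = begin
    ½ * half^ n * ∑ G
      ≡⟨ cong (½ * half^ n *_) (trans (∑-suc G) (sym (∑-+ (G ∘ (false ∷_)) (G ∘ (true ∷_))))) ⟩
    ½ * half^ n * ∑ (λ x → G (false ∷ x) + G (true ∷ x))
      ≡⟨ solve 2 (λ h q → con ½ :* h :* q := h :* (con ½ :* q)) refl (half^ n) (∑ (λ x → G (false ∷ x) + G (true ∷ x))) ⟩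
    half^ n * (½ * ∑ (λ x → G (false ∷ x) + G (true ∷ x)))
      ≡⟨ cong (half^ n *_) (sym (∑-* ½ (λ x → G (false ∷ x) + G (true ∷ x)))) ⟩
    half^ n * ∑ (λ x → ½ * (G (false ∷ x) + G (true ∷ x)))
      ≡⟨ cong (half^ n *_) (∑-cong eq) ⟩
    fourierℚ h s ∎
    where
    open ≡-Reasoning
    G = λ x → g x * chi (b ∷ s) x

  fourierℚ-even : ∀ {n} (g : Vec Bool (suc n) → ℚ) s → fourierℚ g (false ∷ s) ≡ fourierℚ (even g) s
  fourierℚ-even g s = fourierℚ-split g (even g) false s λ x →
    solve 3 (λ a b c → con ½ :* (a :* c :+ b :* c) := con ½ :* (a :+ b) :* c) refl (g (false ∷ x)) (g (true ∷ x)) (chi s x)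

  fourierℚ-odd : ∀ {n} (g : Vec Bool (suc n) → ℚ) s → fourierℚ g (true ∷ s) ≡ fourierℚ (odd g) s
  fourierℚ-odd g s = fourierℚ-split g (odd g) true s λ x →
    trans (cong (λ c → ½ * (g (false ∷ x) * chi s x + g (true ∷ x) * c)) (sign-not (parity s x)))
      (solve 3 (λ a b c → con ½ :* (a :* c :+ b :* (:- c)) := con ½ :* (a :- b) :* c) refl (g (false ∷ x)) (g (true ∷ x)) (chi s x))
    where
    sign-not : ∀ b → (if not b then - 1ℚ else 1ℚ) ≡ - (if b then - 1ℚ else 1ℚ)
    sign-not false = refl
    sign-not true  = refl

  pow : ℚ → ℕ → ℚ
  pow q zero    = 1ℚ
  pow q (suc k) = q * pow q k

  0≤pow : ∀ {q} k → 0ℚ ≤ q → 0ℚ ≤ pow q k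
  0≤pow zero    _   = 0≤ 1ℚ
  0≤pow (suc k) 0≤q = 0≤* 0≤q (0≤pow k 0≤q)

  pow-inverse : ∀ {P q} → P * q ≡ 1ℚ → ∀ k → pow P k * pow q k ≡ 1ℚ
  pow-inverse         _  zero    = refl
  pow-inverse {P} {q} eq (suc k) = trans
    (solve 4 (λ P q a b → (P :* a) :* (q :* b) := (P :* q) :* (a :* b)) refl P q (pow P k) (pow q k))
    (cong₂ _*_ eq (pow-inverse eq k))

  natℚ-^ : ∀ m k → natℚ (m ℕ.^ k) ≡ pow (natℚ m) k
  natℚ-^ m zero    = refl
  natℚ-^ m (suc k) = trans (natℚ-* m (m ℕ.^ k)) (cong (natℚ m *_) (natℚ-^ m k))

  weight : ∀ {n} → ℚ → (Vec Bool n → ℚ) → ℚ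
  weight p g = ∑ (λ s → pow p (card s) * ∣ fourierℚ g s ∣)

  module _ (p : ℚ) (0≤p : 0ℚ ≤ p) where
    open Norm p 0≤p

    -- Sets avoiding the first coordinate contribute the coefficients of `even g`; those containing
    -- it contribute the coefficients of `odd g` with one extra factor `p`.
    weight≡norm : ∀ {n} (g : Vec Bool n → ℚ) → weight p g ≡ norm g
    weight≡norm {zero}  g = trans
      (solve 1 (λ a → con 1ℚ :* a :+ con 0ℚ := a) refl ∣ 1ℚ * (g [] * 1ℚ + 0ℚ) ∣)
      (cong ∣_∣ (solve 1 (λ a → con 1ℚ :* (a :* con 1ℚ :+ con 0ℚ) := a) refl (g [])))
    weight≡norm {suc n} g = begin
      weight p g
        ≡⟨ ∑-suc (λ s → pow p (card s) * ∣ fourierℚ g s ∣) ⟩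
      ∑ (λ s → pow p (card s) * ∣ fourierℚ g (false ∷ s) ∣) + ∑ (λ s → p * pow p (card s) * ∣ fourierℚ g (true ∷ s) ∣)
        ≡⟨ cong₂ _+_
             (∑-cong λ s → cong (λ q → pow p (card s) * ∣ q ∣) (fourierℚ-even g s))
             (∑-cong λ s → trans (cong (λ q → p * pow p (card s) * ∣ q ∣) (fourierℚ-odd g s)) (*-assoc p (pow p (card s)) _)) ⟩
      weight p (even g) + ∑ (λ s → p * (pow p (card s) * ∣ fourierℚ (odd g) s ∣))
        ≡⟨ cong (weight p (even g) +_) (∑-* p (λ s → pow p (card s) * ∣ fourierℚ (odd g) s ∣)) ⟩
      weight p (even g) + p * weight p (odd g)
        ≡⟨ cong₂ (λ a b → a + p * b) (weight≡norm (even g)) (weight≡norm (odd g)) ⟩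
      norm g ∎
      where open ≡-Reasoning

    level≤weight : ∀ {n} k (f : Vec Bool n → Bool) → pow p k * Lk k f ≤ weight p (b2q ∘ f)
    level≤weight {n} k f = go (allBits n)
      where
      F : Subset n → ℚ
      F s = ∣ fourier f s ∣
      go : ∀ ss → pow p k * sumℚ (map F (filterᵇ (λ s → card s ≡ᵇ k) ss)) ≤ sumℚ (map (λ s → pow p (card s) * F s) ss)
      go []       = ≤-reflexive (*-zeroʳ (pow p k))
      go (s ∷ ss) with card s ≡ᵇ k in eq
      ... | true  = subst (_≤ pow p (card s) * F s + _) (sym (*-distribˡ-+ (pow p k) (F s) _))
        (+-mono-≤ (≤-reflexive (cong (λ j → pow p j * F s) (sym (ℕ.≡ᵇ⇒≡ (card s) k (subst T (sym eq) _))))) (go ss))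
      ... | false = subst (_≤ pow p (card s) * F s + _) (+-identityˡ (pow p k * _))
        (+-mono-≤ (0≤* (0≤pow (card s) 0≤p) (0≤∣p∣ (fourier f s))) (go ss))

  -- Invariance under permutations of the coordinates.

  ∈-allBits : ∀ {n} (x : Vec Bool n) → x ∈ allBits n
  ∈-allBits []          = here refl
  ∈-allBits (false ∷ x) = ∈-++⁺ˡ (∈-map⁺ (false ∷_) (∈-allBits x))
  ∈-allBits (true  ∷ x) = ∈-++⁺ʳ (map (false ∷_) (allBits _)) (∈-map⁺ (true ∷_) (∈-allBits x))

  allBits-unique : ∀ n → Unique (allBits n)
  allBits-unique zero    = [] ∷ []
  allBits-unique (suc n) = Unique.++⁺ (Unique.map⁺ ∷-injectiveʳ (allBits-unique n)) (Unique.map⁺ ∷-injectiveʳ (allBits-unique n))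
    λ { (x∈f , x∈t) → disjoint (∈-map⁻ (false ∷_) x∈f) (∈-map⁻ (true ∷_) x∈t) }
    where
    disjoint : ∀ {x} → ∃ (λ y → y ∈ allBits n × x ≡ false ∷ y) → ¬ ∃ (λ y → y ∈ allBits n × x ≡ true ∷ y)
    disjoint (_ , _ , refl) (_ , _ , ())

  permuteBits-inverse : ∀ {n} (π : Permutation′ n) x → permuteBits π (permuteBits (flip π) x) ≡ x
  permuteBits-inverse π x = begin
    tabulate (λ i → lookup (tabulate (λ j → lookup x (π ⟨$⟩ˡ j))) (π ⟨$⟩ʳ i))
      ≡⟨ tabulate-cong (λ i → trans (lookup∘tabulate _ (π ⟨$⟩ʳ i)) (cong (lookup x) (inverseˡ π))) ⟩
    tabulate (lookup x)
      ≡⟨ tabulate∘lookup x ⟩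
    x ∎
    where open ≡-Reasoning

  permuteBits-injective : ∀ {n} (π : Permutation′ n) {x y} → permuteBits π x ≡ permuteBits π y → x ≡ y
  permuteBits-injective π {x} {y} eq = trans (sym (permuteBits-inverse (flip π) x))
    (trans (cong (permuteBits (flip π)) eq) (permuteBits-inverse (flip π) y))

  -- Both lists are free of duplicates and contain every vector, hence they agree as bags.
  permute-allBits : ∀ {n} (π : Permutation′ n) → map (permuteBits π) (allBits n) ↭ allBits n
  permute-allBits {n} π = ∼bag⇒↭ (unique∧set⇒bag
    (Unique.map⁺ (permuteBits-injective π) (allBits-unique n)) (allBits-unique n)
    λ {x} → mk⇔ (λ _ → ∈-allBits x)
      (λ _ → subst (_∈ map (permuteBits π) (allBits n)) (permuteBits-inverse π x) (∈-map⁺ (permuteBits π) (∈-allBits (permuteBits (flip π) x)))))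

  ∑-permute : ∀ {n} (π : Permutation′ n) (g : Vec Bool n → ℚ) → ∑ (g ∘ permuteBits π) ≡ ∑ g
  ∑-permute {n} π g = trans (cong sumℚ (map-∘ (allBits n))) (sumℚ-↭ (Perm.map⁺ g (permute-allBits π)))

  module _ {c ℓ} (M : CommutativeMonoid c ℓ) where
    open CommutativeMonoid M using (Carrier; _≈_)
      renaming (sym to ≈-sym; trans to ≈-trans; reflexive to ≈-reflexive)
    open Sum M using (sum; sum-permute; sum-cong-≗)

    -- The general monoid covers both uses: addition on `ℕ` for cardinality, xor for parity.
    sum-permuteBits : ∀ {n} (π : Permutation′ n) (h : Bool → Carrier) x →
      sum (h ∘ lookup (permuteBits π x)) ≈ sum (h ∘ lookup x)
    sum-permuteBits π h x = ≈-trans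
      (≈-reflexive (sum-cong-≗ {n = _} {h ∘ lookup (permuteBits π x)} (λ i → cong h (lookup∘tabulate (λ j → lookup x (π ⟨$⟩ʳ j)) i))))
      (≈-sym (sum-permute (h ∘ lookup x) π))

  xor-monoid : CommutativeMonoid _ _
  xor-monoid = CommutativeRing.+-commutativeMonoid xor-∧-commutativeRing

  parity-sum : ∀ {n} (s : Subset n) x → parity s x ≡ Sum.sum xor-monoid (lookup (zipWith _∧_ s x))
  parity-sum []      []      = refl
  parity-sum (b ∷ s) (c ∷ x) = cong ((b ∧ c) xor_) (parity-sum s x)

  card-sum : ∀ {n} (s : Subset n) → card s ≡ Sum.sum ℕ.+-0-commutativeMonoid ((λ b → if b then 1 else 0) ∘ lookup s)
  card-sum []          = refl
  card-sum (false ∷ s) = card-sum s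
  card-sum (true  ∷ s) = cong suc (card-sum s)

  card-permute : ∀ {n} (π : Permutation′ n) s → card (permuteBits π s) ≡ card s
  card-permute π s = trans (card-sum (permuteBits π s))
    (trans (sum-permuteBits ℕ.+-0-commutativeMonoid π (λ b → if b then 1 else 0) s) (sym (card-sum s)))

  parity-permute : ∀ {n} (π : Permutation′ n) s x → parity (permuteBits π s) (permuteBits π x) ≡ parity s x
  parity-permute π s x = begin
    parity (permuteBits π s) (permuteBits π x)
      ≡⟨ parity-sum (permuteBits π s) (permuteBits π x) ⟩
    Sum.sum xor-monoid (lookup (zipWith _∧_ (permuteBits π s) (permuteBits π x)))
      ≡⟨ Sum.sum-cong-≗ xor-monoid (λ i → zipWith-permute i) ⟩
    Sum.sum xor-monoid (lookup (permuteBits π (zipWith _∧_ s x)))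
      ≡⟨ sum-permuteBits xor-monoid π (λ b → b) (zipWith _∧_ s x) ⟩
    Sum.sum xor-monoid (lookup (zipWith _∧_ s x))
      ≡⟨ parity-sum s x ⟨
    parity s x ∎
    where
    open ≡-Reasoning
    zipWith-permute : ∀ i → lookup (zipWith _∧_ (permuteBits π s) (permuteBits π x)) i ≡ lookup (permuteBits π (zipWith _∧_ s x)) i
    zipWith-permute i = begin
      lookup (zipWith _∧_ (permuteBits π s) (permuteBits π x)) i
        ≡⟨ lookup-zipWith _∧_ i (permuteBits π s) (permuteBits π x) ⟩
      lookup (permuteBits π s) i ∧ lookup (permuteBits π x) i
        ≡⟨ cong₂ _∧_ (lookup∘tabulate _ i) (lookup∘tabulate _ i) ⟩
      lookup s (π ⟨$⟩ʳ i) ∧ lookup x (π ⟨$⟩ʳ i)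
        ≡⟨ lookup-zipWith _∧_ (π ⟨$⟩ʳ i) s x ⟨
      lookup (zipWith _∧_ s x) (π ⟨$⟩ʳ i)
        ≡⟨ lookup∘tabulate _ i ⟨
      lookup (permuteBits π (zipWith _∧_ s x)) i ∎

  fourierℚ-permute : ∀ {n} (π : Permutation′ n) (g : Vec Bool n → ℚ) s →
    fourierℚ (g ∘ permuteBits π) s ≡ fourierℚ g (permuteBits π s)
  fourierℚ-permute {n} π g s = cong (half^ n *_) (trans
    (∑-cong λ x → cong (λ b → g (permuteBits π x) * (if b then - 1ℚ else 1ℚ)) (sym (parity-permute π s x)))
    (∑-permute π (λ x → g x * chi (permuteBits π s) x)))

  weight-cong : ∀ {n} p {g h : Vec Bool n → ℚ} → (∀ x → g x ≡ h x) → weight p g ≡ weight p h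
  weight-cong {n} p eq = ∑-cong λ s → cong (λ q → pow p (card s) * ∣ half^ n * q ∣) (∑-cong λ x → cong (_* chi s x) (eq x))

  -- Permuting the inputs permutes the Fourier coefficients within each level, so the order in which
  -- the program reads its input does not affect the weight.
  weight-permute : ∀ {n} p (π : Permutation′ n) (g : Vec Bool n → ℚ) → weight p (g ∘ permuteBits π) ≡ weight p g
  weight-permute p π g = trans
    (∑-cong λ s → cong₂ (λ k q → pow p k * ∣ q ∣) (sym (card-permute π s)) (fourierℚ-permute π g s))
    (∑-permute π (λ s → pow p (card s) * ∣ fourierℚ g s ∣))

  -- Choice of the parameters and the final bound.

  half^≡pow : ∀ n → half^ n ≡ pow ½ n
  half^≡pow zero    = refl
  half^≡pow (suc n) = cong (½ *_) (half^≡pow n)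

  -- Write `ℓ` for the logarithm. If `2^ℓ < n`, then `2^(ℓ+1) ≤ 3n`, which forces `ℓ + 1 ≤ ℓ`.
  n≤2^⌈log₂3n⌉ : ∀ n → n ℕ.≤ 2 ℕ.^ ⌈log₂ (3 ℕ.* n) ⌉
  n≤2^⌈log₂3n⌉ n with n ℕ.≤? 2 ℕ.^ ⌈log₂ (3 ℕ.* n) ⌉
  ... | yes n≤ = n≤
  ... | no  n≰ = contradiction
    (subst (ℕ._≤ ⌈log₂ (3 ℕ.* n) ⌉) (⌈log₂2^n⌉≡n (suc ⌈log₂ (3 ℕ.* n) ⌉))
      (⌈log₂⌉-mono-≤ (ℕ.*-mono-≤ (ℕ.n≤1+n 2) (ℕ.<⇒≤ (ℕ.≰⇒> n≰)))))
    ℕ.1+n≰n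

  1+n≤8n² : ∀ {n} → 1 ℕ.≤ n → suc n ℕ.≤ 8 ℕ.* n ℕ.^ 2
  1+n≤8n² {suc m} _ = ℕ.≤-trans
    (ℕ.+-mono-≤ {1} {suc m} {suc m} {7 ℕ.* suc m} (s≤s z≤n) (ℕ.m≤m+n (suc m) _))
    (ℕ.*-monoʳ-≤ 8 (ℕ.m≤m*n (suc m) (suc m ℕ.^ 1) {{ℕ.m^n≢0 (suc m) 1}}))

  module _ (n : ℕ) (1≤n : 1 ℕ.≤ n) where

    private
      ℓ = ⌈log₂ (3 ℕ.* n) ⌉
      P = natℚ (24 ℕ.* ℓ)

      -- From `n ≥ 1` and `⌈log₂ 3⌉ = 2` comes `ℓ ≥ 2`; this makes `P` invertible and `p` at most
      -- 1/48.
      48≤P : natℚ 48 ≤ P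
      48≤P = natℚ-mono (ℕ.*-monoʳ-≤ 24 (⌈log₂⌉-mono-≤ {3} (ℕ.*-monoʳ-≤ 3 1≤n)))

      instance
        P-positive : Positive P
        P-positive = positive (<-≤-trans (positive⁻¹ (natℚ 48)) 48≤P)

        P-nonZero : NonZero P
        P-nonZero = pos⇒nonZero P

      p : ℚ
      p = 1/ P

      Pp≡1 : P * p ≡ 1ℚ
      Pp≡1 = *-inverseʳ P

      0≤p : 0ℚ ≤ p
      0≤p = <⇒≤ (positive⁻¹ p {{1/pos⇒pos P}})

      p≤1/40 : p ≤ 1/40
      p≤1/40 = ≤-from-difference (0≤* (0≤ (1 ÷ 48)) (0≤* (≤⇒0≤- 48≤P) 0≤p) ⟨+⟩ 0≤ (1 ÷ 240))
        (trans (solve 1 (λ p → con 1/40 :- p := con (1 ÷ 48) :* (con 1ℚ :- con (natℚ 48) :* p) :+ con (1 ÷ 240)) refl p)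
          (trans (cong (λ q → 1 ÷ 48 * (q - natℚ 48 * p) + 1 ÷ 240) (sym Pp≡1))
            (solve 2 (λ p P → con (1 ÷ 48) :* (P :* p :- con (natℚ 48) :* p) :+ con (1 ÷ 240) :=
              con (1 ÷ 48) :* ((P :- con (natℚ 48)) :* p) :+ con (1 ÷ 240)) refl p P)))

      -- This is an equality by the choice of `p`, and the origin of the constant 24: the slope may
      -- fall from ⅓ to ¼ over `ℓ` drops of `2p`.
      pℓ≤1/24 : p * natℚ ℓ ≤ 1/24
      pℓ≤1/24 = ≤-reflexive (trans
        (solve 2 (λ p l → p :* l := con 1/24 :* ((con (natℚ 24) :* l) :* p)) refl p (natℚ ℓ))
        (cong (1/24 *_) (trans (cong (_* p) (sym (natℚ-* 24 ℓ))) Pp≡1)))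

      open Layer p ℓ 0≤p p≤1/40 pℓ≤1/24

      -- With `J = ℓ` the growth over all layers is `n * half^ ℓ`, at most 1 because `n ≤ 2^ℓ`.
      scale≤2 : scale n ≤ 2ℚ
      scale≤2 = +-monoʳ-≤ 1ℚ (≤-trans
        (*-monoʳ-≤-nonNeg (half^ ℓ) {{nonNegative (0≤half^ ℓ)}} (natℚ-mono (n≤2^⌈log₂3n⌉ n)))
        (≤-reflexive (trans (cong₂ _*_ (natℚ-^ 2 ℓ) (half^≡pow ℓ)) (pow-inverse {natℚ 2} {½} refl ℓ))))

    level-bound : ∀ k (f : Vec Bool n → Bool) → ROBP 3 n f → Lk k f ≤ natℚ (8 ℕ.* n ℕ.^ 2 ℕ.* (24 ℕ.* ℓ) ℕ.^ k)
    level-bound k f (B , π , f≡) = begin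
      Lk k f
        ≡⟨ *-identityˡ (Lk k f) ⟨
      1ℚ * Lk k f
        ≡⟨ cong (_* Lk k f) (pow-inverse Pp≡1 k) ⟨
      pow P k * pow p k * Lk k f
        ≡⟨ *-assoc (pow P k) (pow p k) (Lk k f) ⟩
      pow P k * (pow p k * Lk k f)
        ≤⟨ *-mono (0≤pow k (0≤natℚ (24 ℕ.* ℓ))) level≤ ⟩
      pow P k * natℚ (suc n)
        ≡⟨ *-comm (pow P k) (natℚ (suc n)) ⟩
      natℚ (suc n) * pow P k
        ≡⟨ cong (natℚ (suc n) *_) (natℚ-^ (24 ℕ.* ℓ) k) ⟨
      natℚ (suc n) * natℚ ((24 ℕ.* ℓ) ℕ.^ k)
        ≡⟨ natℚ-* (suc n) ((24 ℕ.* ℓ) ℕ.^ k) ⟨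
      natℚ (suc n ℕ.* (24 ℕ.* ℓ) ℕ.^ k)
        ≤⟨ natℚ-mono (ℕ.*-monoˡ-≤ ((24 ℕ.* ℓ) ℕ.^ k) (1+n≤8n² 1≤n)) ⟩
      natℚ (8 ℕ.* n ℕ.^ 2 ℕ.* (24 ℕ.* ℓ) ℕ.^ k) ∎
      where
      open ≤-Reasoning
      open OrderedBP B using (accept) renaming (start to u₀; trans to τ)
      g : Vec Bool n → ℚ
      g = accepts accept τ u₀
      level≤ : pow p k * Lk k f ≤ natℚ (suc n)
      level≤ = begin
        pow p k * Lk k f
          ≤⟨ level≤weight p 0≤p k f ⟩
        weight p (b2q ∘ f)
          ≡⟨ weight-cong p (λ x → cong b2q (f≡ x)) ⟩
        weight p (g ∘ permuteBits π)
          ≡⟨ weight-permute p π g ⟩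
        weight p g
          ≡⟨ weight≡norm p 0≤p g ⟩
        Norm.norm p 0≤p g
          ≤⟨ norm-accepts n accept τ scale≤2 u₀ ⟩
        1ℚ + natℚ n
          ≡⟨ natℚ-+ 1 n ⟨
        natℚ (suc n) ∎

open import Data.Bool using (Bool)
open import Data.Nat using (ℕ; _≤_; _*_; _^_)
open import Data.Nat.Logarithm using (⌈log₂_⌉)
open import Data.Vec using (Vec)
open import Data.Rational using (ℚ) renaming (_≤_ to _≤ℚ_)
open import Data.Product using (∃; _,_)
open import Data.Nat.Properties using (≤-trans)

theorem3p1 : ∃ λ (C : ℕ) → ∀ (n : ℕ) (f : Vec Bool n → Bool) → ROBP 3 n f →
    ∀ (k : ℕ) → 1 ≤ k → k ≤ n →
    Lk k f ≤ℚ natℚ (8 * n ^ 2 * (C * ⌈log₂ (3 * n) ⌉) ^ k)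
theorem3p1 = 24 , λ n f robp k 1≤k k≤n → SpectralBound.level-bound n (≤-trans 1≤k k≤n) k f robp
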